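{- Let $\mathbb C$ be a strict Cartesian category. Suppose $(i,\mathbf s):\mathbf T\times\mathbf X\to\bigcirc\mathbf U\times\mathbf Y$ and $(j,\mathbf g):\mathbf U\to\mathbf T$ are morphisms in $\mathrm{St}(\mathbb C)$ (given by stateful morphism sequences). For any $u:1\to\mathbf U_0$ in $\mathbb C$, $$\mathrm{tr}^{\mathbf U}_{u}\big((i,\mathbf s)\circ((j,\mathbf g)\times\mathrm{id}_{\mathbf X})\big)=\mathrm{tr}^{\mathbf T}_{u'}\big(((j',\bigcirc\mathbf g)\times\mathrm{id}_{\mathbf Y})\circ(i,\mathbf s)\big),$$ where $j':1\to\mathrm{nxt}\,\mathbf g_0$ and $u':1\to\mathbf T_0$ are determined by $\langle j',u'\rangle=U\mathbf g_0\circ\langle j,u\rangle$.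
   Context: $\mathbb C$ is a Cartesian category with strictly associative and unital chosen products $\times$, terminal object $1$, $!_X:X\to1$. Equations between morphisms are written with generalized elements. Sequences are indexed by $\mathbb N$; $[e_k]_k$ is the sequence with $k$th entry $e_k$, $[X]$ the constant sequence, and $\bigcirc\mathbf T=[\mathbf T_{k+1}]_k$ the tail (also for sequences of 2-cells). 2-cells: a 2-cell $f$ consists of objects $S=\mathrm{prv}\,f$, $X=\mathrm{dom}\,f$, $S'=\mathrm{nxt}\,f$, $Y=\mathrm{cod}\,f$ together with an underlying morphism $Uf:S\times X\to S'\times Y$ in $\mathbb C$ ($S,S'$ are state types, $X,Y$ value types). Horizontal composition: if also $g$ has $Ug:T\times Y\to T'\times Z$, then $g*f$ has $\mathrm{prv}=S\times T$, $\mathrm{dom}=X$, $\mathrm{nxt}=S'\times T'$, $\mathrm{cod}=Z$ and $U(g*f)(s,t,x)=(s',t',z)$ where $(s',y)=Uf(s,x)$, $(t',z)=Ug(t,y)$. Vertical composition: if $h$ has $Uh:S'\times V\to S''\times W$, then $f;h$ has $\mathrm{prv}=S$, $\mathrm{dom}=X\times V$, $\mathrm{nxt}=S''$, $\mathrm{cod}=Y\times W$ and $U(f;h)(s,x,v)=(s'',y,w)$ where $(s',y)=Uf(s,x)$, $(s'',w)=Uh(s',v)$. For $\phi:X\to Y$ in $\mathbb C$, $\phi^h$ is the 2-cell with underlying morphism $\phi$, $\mathrm{prv}=\mathrm{nxt}=1$, $\mathrm{dom}=X$, $\mathrm{cod}=Y$; $\phi^v$ is the 2-cell with underlying morphism $\phi$,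 $\mathrm{prv}=X$, $\mathrm{nxt}=Y$, $\mathrm{dom}=\mathrm{cod}=1$. Stateful morphism sequences: for $\mathbf X,\mathbf Y\in|\mathbb C|^{\mathbb N}$, a stateful morphism sequence $(i,\mathbf s):\mathbf X\to\mathbf Y$ is a sequence $\mathbf s$ of 2-cells with $\mathrm{dom}\,\mathbf s_k=\mathbf X_k$, $\mathrm{cod}\,\mathbf s_k=\mathbf Y_k$, $\mathrm{nxt}\,\mathbf s_k=\mathrm{prv}\,\mathbf s_{k+1}$ for all $k$, and a morphism $i:1\to\mathrm{prv}\,\mathbf s_0$. Its $n$th truncation is $\mathrm{Tc}_n(i,\mathbf s)=U(i^v;\mathbf s_0;\cdots;\mathbf s_n;(!_{\mathrm{nxt}\,\mathbf s_n})^v):\prod_{k=0}^n\mathbf X_k\to\prod_{k=0}^n\mathbf Y_k$. Two stateful morphism sequences $\mathbf X\to\mathbf Y$ are extensionally equal if all their truncations agree. $\mathrm{St}(\mathbb C)$ has objects $|\mathbb C|^{\mathbb N}$ and morphisms the extensional equivalence classes of stateful morphism sequences. Identity on $\mathbf X$: $(\mathrm{id}_1,[(\mathrm{id}_{\mathbf X_k})^h]_k)$. Composition of $(j,\mathbf t):\mathbf X\to\mathbf Y$ and $(i,\mathbf s):\mathbf Y\to\mathbf Z$: $(i,\mathbf s)\circ(j,\mathbf t)=(\langle j,i\rangle,[\mathbf s_k*\mathbf t_k]_k)$ (well defined on classes). $\mathrm{St}(\mathbb C)$ is Cartesian with terminal object $[1]$, $\mathbf X\times\mathbf Y=[\mathbf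 X_k\times\mathbf Y_k]_k$ and projections $(\mathrm{id}_1,[\pi_n^h]_k)$. Delayed trace: if a 2-cell $f$ has $\mathrm{prv}\,f=S$, $\mathrm{dom}\,f=T\times X$, $\mathrm{nxt}\,f=S'$, $\mathrm{cod}\,f=T'\times Y$, its value-to-state conversion ${}^{T}\lfloor f\rceil_{T'}$ is the 2-cell with the same underlying morphism but $\mathrm{prv}=S\times T$, $\mathrm{dom}=X$, $\mathrm{nxt}=S'\times T'$, $\mathrm{cod}=Y$. For $(i,\mathbf s):\mathbf T\times\mathbf X\to\bigcirc\mathbf T\times\mathbf Y$ in $\mathrm{St}(\mathbb C)$ and $p:1\to\mathbf T_0$ in $\mathbb C$, the delayed trace is $\mathrm{tr}^{\mathbf T}_p(i,\mathbf s)=(\langle i,p\rangle,[{}^{\mathbf T_k}\lfloor\mathbf s_k\rceil_{\mathbf T_{k+1}}]_k):\mathbf X\to\mathbf Y$ (well defined on classes). -}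

module Defs where

open import Level using (Level; _⊔_) renaming (suc to lsuc)
open import Data.Nat.Base using (ℕ; zero; suc)
open import Relation.Binary.Bundles using (Setoid)
open import Relation.Binary.Structures using (IsEquivalence)
open import Relation.Binary.PropositionalEquality.Core as ≡
  using (_≡_; subst; subst₂)
import Relation.Binary.Reasoning.Setoid as SetoidReasoning

record CartesianCategory (o ℓ e : Level) : Set (lsuc (o ⊔ ℓ ⊔ e)) where
  infix  4 _≈_ _⇒_
  infixr 9 _∘_
  infixr 7 _×_ _⁂_
  infix 11 ⟨_,_⟩
  field
    Obj : Set o
    _⇒_ : Obj → Obj → Set ℓ
    _≈_ : ∀ {A B} → A ⇒ B → A ⇒ B → Set e

    id  : ∀ {A} → A ⇒ A
    _∘_ : ∀ {A B C} → B ⇒ C → A ⇒ B → A ⇒ C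

    isEquivalence : ∀ {A B} → IsEquivalence (_≈_ {A} {B})
    ∘-cong    : ∀ {A B C} {f f′ : B ⇒ C} {g g′ : A ⇒ B} →
                f ≈ f′ → g ≈ g′ → f ∘ g ≈ f′ ∘ g′
    assoc     : ∀ {A B C D} {f : A ⇒ B} {g : B ⇒ C} {h : C ⇒ D} →
                (h ∘ g) ∘ f ≈ h ∘ (g ∘ f)
    identityˡ : ∀ {A B} {f : A ⇒ B} → id ∘ f ≈ f
    identityʳ : ∀ {A B} {f : A ⇒ B} → f ∘ id ≈ f

    ⊤        : Obj
    !        : ∀ {A} → A ⇒ ⊤
    !-unique : ∀ {A} (f : A ⇒ ⊤) → ! ≈ f

    _×_      : Obj → Obj → Obj
    π₁       : ∀ {A B} → A × B ⇒ A
    π₂       : ∀ {A B} → A × B ⇒ B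
    ⟨_,_⟩    : ∀ {A B C} → C ⇒ A → C ⇒ B → C ⇒ A × B
    project₁ : ∀ {A B C} {f : C ⇒ A} {g : C ⇒ B} → π₁ ∘ ⟨ f , g ⟩ ≈ f
    project₂ : ∀ {A B C} {f : C ⇒ A} {g : C ⇒ B} → π₂ ∘ ⟨ f , g ⟩ ≈ g
    unique   : ∀ {A B C} {h : C ⇒ A × B} {f : C ⇒ A} {g : C ⇒ B} →
               π₁ ∘ h ≈ f → π₂ ∘ h ≈ g → ⟨ f , g ⟩ ≈ h

  _⁂_ : ∀ {A B C D} → A ⇒ C → B ⇒ D → A × B ⇒ C × D
  f ⁂ g = ⟨ f ∘ π₁ , g ∘ π₂ ⟩

  cast : ∀ {A B} → A ≡ B → A ⇒ B
  cast {A} p = subst (A ⇒_) p id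

  homSetoid : Obj → Obj → Setoid ℓ e
  homSetoid A B = record { isEquivalence = isEquivalence {A} {B} }

  module Equiv {A B} = IsEquivalence (isEquivalence {A} {B})

-- Strictness identifies the objects, and also requires the canonical
-- associativity and unit isomorphisms to be the resulting identities.
record StrictCartesianCategory (o ℓ e : Level) : Set (lsuc (o ⊔ ℓ ⊔ e)) where
  field
    cartesian : CartesianCategory o ℓ e
  open CartesianCategory cartesian public
  field
    ×-assoc : ∀ A B C → (A × B) × C ≡ A × (B × C)
    ×-unitˡ : ∀ A → ⊤ × A ≡ A
    ×-unitʳ : ∀ A → A × ⊤ ≡ A
    cast-assoc : ∀ A B C →
                 cast (×-assoc A B C) ≈ ⟨ π₁ ∘ π₁ , ⟨ π₂ ∘ π₁ , π₂ ⟩ ⟩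
    cast-unitˡ : ∀ A → cast (×-unitˡ A) ≈ π₂
    cast-unitʳ : ∀ A → cast (×-unitʳ A) ≈ π₁

module TwoCells {o ℓ e} (ℂ : StrictCartesianCategory o ℓ e) where
  open StrictCartesianCategory ℂ

  infixl 8 _✶_
  infixl 7 _；_
  infix 10 _ʰ _ᵛ

  record TwoCell (prv dom nxt cod : Obj) : Set ℓ where
    constructor cell
    field
      U : prv × dom ⇒ nxt × cod
  open TwoCell public

  _✶_ : ∀ {S S′ T T′ X Y Z} →
        TwoCell T Y T′ Z → TwoCell S X S′ Y → TwoCell (S × T) X (S′ × T′) Z
  _✶_ {S} {S′} {T} {T′} {X} {Y} {Z} g f =
    cell ⟨ ⟨ π₁ ∘ s′y , π₁ ∘ t′z ⟩ , π₂ ∘ t′z ⟩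
    where
    s′y : (S × T) × X ⇒ S′ × Y
    s′y = U f ∘ ⟨ π₁ ∘ π₁ , π₂ ⟩
    t′z : (S × T) × X ⇒ T′ × Z
    t′z = U g ∘ ⟨ π₂ ∘ π₁ , π₂ ∘ s′y ⟩

  _；_ : ∀ {S S′ S″ X Y V W} →
        TwoCell S X S′ Y → TwoCell S′ V S″ W → TwoCell S (X × V) S″ (Y × W)
  _；_ {S} {S′} {S″} {X} {Y} {V} {W} f h =
    cell ⟨ π₁ ∘ s″w , ⟨ π₂ ∘ s′y , π₂ ∘ s″w ⟩ ⟩
    where
    s′y : S × (X × V) ⇒ S′ × Y
    s′y = U f ∘ ⟨ π₁ , π₁ ∘ π₂ ⟩
    s″w : S × (X × V) ⇒ S″ × W
    s″w = U h ∘ ⟨ π₁ ∘ s′y , π₂ ∘ π₂ ⟩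

  _ʰ : ∀ {X Y} → X ⇒ Y → TwoCell ⊤ X ⊤ Y
  _ʰ {X} {Y} φ = cell (subst₂ _⇒_ (≡.sym (×-unitˡ X)) (≡.sym (×-unitˡ Y)) φ)

  _ᵛ : ∀ {X Y} → X ⇒ Y → TwoCell X ⊤ Y ⊤
  _ᵛ {X} {Y} φ = cell (subst₂ _⇒_ (≡.sym (×-unitʳ X)) (≡.sym (×-unitʳ Y)) φ)

  ⌊_⌉ : ∀ {S T X S′ T′ Y} →
        TwoCell S (T × X) S′ (T′ × Y) → TwoCell (S × T) X (S′ × T′) Y
  ⌊_⌉ {S} {T} {X} {S′} {T′} {Y} f =
    cell (subst₂ _⇒_ (≡.sym (×-assoc S T X)) (≡.sym (×-assoc S′ T′ Y)) (U f))

module StatefulMorphisms {o ℓ e} (ℂ : StrictCartesianCategory o ℓ e) where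
  open StrictCartesianCategory ℂ
  open TwoCells ℂ public

  ObjSeq : Set o
  ObjSeq = ℕ → Obj

  ○ : ObjSeq → ObjSeq
  ○ X k = X (suc k)

  infixr 7 _×ˢ_
  _×ˢ_ : ObjSeq → ObjSeq → ObjSeq
  (X ×ˢ Y) k = X k × Y k

  -- The matching condition nxt (cells k) = prv (cells (suc k)) is built into
  -- the indexing by the sequence of state types.
  record Stateful (X Y : ObjSeq) : Set (o ⊔ ℓ) where
    constructor stateful
    field
      state : ObjSeq
      init  : ⊤ ⇒ state 0
      cells : ∀ k → TwoCell (state k) (X k) (state (suc k)) (Y k)
  open Stateful public

  -- ∏ X n is X 0 × ⋯ × X n, with n included.
  ∏ : ObjSeq → ℕ → Obj
  ∏ X zero      = X 0
  ∏ X (suc n) = ∏ X n × X (suc n)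

  -- Unlike ∏, this keeps the unit factor contributed by the cell init ᵛ.
  ⊤×∏ : ObjSeq → ℕ → Obj
  ⊤×∏ X zero      = ⊤ × X 0
  ⊤×∏ X (suc n) = ⊤×∏ X n × X (suc n)

  ⊤×∏≡∏ : ∀ X n → ⊤×∏ X n ≡ ∏ X n
  ⊤×∏≡∏ X zero      = ×-unitˡ (X 0)
  ⊤×∏≡∏ X (suc n) = ≡.cong (_× X (suc n)) (⊤×∏≡∏ X n)

  boundary≡∏ : ∀ X n → ⊤ × (⊤×∏ X n × ⊤) ≡ ∏ X n
  boundary≡∏ X n =
    ≡.trans (×-unitˡ _) (≡.trans (×-unitʳ _) (⊤×∏≡∏ X n))

  module _ {X Y : ObjSeq} where

    -- init ᵛ ； cells 0 ； ⋯ ； cells n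
    unroll : (f : Stateful X Y) (n : ℕ) →
             TwoCell ⊤ (⊤×∏ X n) (state f (suc n)) (⊤×∏ Y n)
    unroll f zero      = init f ᵛ ； cells f 0
    unroll f (suc n) = unroll f n ； cells f (suc n)

    Tc : (n : ℕ) → Stateful X Y → ∏ X n ⇒ ∏ Y n
    Tc n f = subst₂ _⇒_ (boundary≡∏ X n) (boundary≡∏ Y n)
                        (U (unroll f n ； ! ᵛ))

    infix 4 _≈ˢ_
    _≈ˢ_ : Stateful X Y → Stateful X Y → Set e
    f ≈ˢ g = ∀ n → Tc n f ≈ Tc n g

  pure : ∀ {X Y : ObjSeq} → (∀ k → X k ⇒ Y k) → Stateful X Y
  pure φ = stateful (λ _ → ⊤) id (λ k → φ k ʰ)

  idˢ : ∀ {X} → Stateful X X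
  idˢ = pure (λ _ → id)

  infixr 9 _∘ˢ_
  _∘ˢ_ : ∀ {X Y Z} → Stateful Y Z → Stateful X Y → Stateful X Z
  stateful S i s ∘ˢ stateful T j t =
    stateful (T ×ˢ S) ⟨ j , i ⟩ (λ k → s k ✶ t k)

  pairCell : ∀ {S S′ T T′ X Y Z} → TwoCell S X S′ Y → TwoCell T X T′ Z →
             TwoCell (S × T) X (S′ × T′) (Y × Z)
  pairCell {S} {S′} {T} {T′} {X} {Y} {Z} f g =
    cell ⟨ ⟨ π₁ ∘ s′y , π₁ ∘ t′z ⟩ , ⟨ π₂ ∘ s′y , π₂ ∘ t′z ⟩ ⟩
    where
    s′y : (S × T) × X ⇒ S′ × Y
    s′y = U f ∘ ⟨ π₁ ∘ π₁ , π₂ ⟩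
    t′z : (S × T) × X ⇒ T′ × Z
    t′z = U g ∘ ⟨ π₂ ∘ π₁ , π₂ ⟩

  ⟨_,_⟩ˢ : ∀ {X Y Z} → Stateful X Y → Stateful X Z → Stateful X (Y ×ˢ Z)
  ⟨ stateful S i s , stateful T j t ⟩ˢ =
    stateful (S ×ˢ T) ⟨ i , j ⟩ (λ k → pairCell (s k) (t k))

  tr : ∀ {X Y} (T : ObjSeq) → ⊤ ⇒ T 0 →
       Stateful (T ×ˢ X) (○ T ×ˢ Y) → Stateful X Y
  tr T p (stateful S i s) = stateful (S ×ˢ T) ⟨ i , p ⟩ (λ k → ⌊ s k ⌉)

  tail : ∀ {X Y} (f : Stateful X Y) → ⊤ ⇒ state f 1 → Stateful (○ X) (○ Y)
  tail f j = stateful (○ (state f)) j (λ k → cells f (suc k))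

module CartesianProperties {o ℓ e} (𝒞 : CartesianCategory o ℓ e) where
  open CartesianCategory 𝒞
  open Equiv

  module HomReasoning {A B : Obj} = SetoidReasoning (homSetoid A B)
  open HomReasoning

  private variable
    A B C D : Obj
    f g h k : A ⇒ B

  ∘-congˡ : g ≈ h → f ∘ g ≈ f ∘ h
  ∘-congˡ = ∘-cong refl

  ∘-congʳ : f ≈ g → f ∘ h ≈ g ∘ h
  ∘-congʳ p = ∘-cong p refl

  !-unique₂ : {f g : A ⇒ ⊤} → f ≈ g
  !-unique₂ = trans (sym (!-unique _)) (!-unique _)

  ⟨⟩-cong : f ≈ h → g ≈ k → ⟨ f , g ⟩ ≈ ⟨ h , k ⟩
  ⟨⟩-cong p q = unique (trans project₁ (sym p)) (trans project₂ (sym q))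

  ⟨⟩∘ : ⟨ f , g ⟩ ∘ h ≈ ⟨ f ∘ h , g ∘ h ⟩
  ⟨⟩∘ = sym (unique (trans (sym assoc) (∘-congʳ project₁))
                    (trans (sym assoc) (∘-congʳ project₂)))

  η : {h : C ⇒ A × B} → ⟨ π₁ ∘ h , π₂ ∘ h ⟩ ≈ h
  η = unique refl refl

  pullʳ : f ∘ g ≈ k → (h ∘ f) ∘ g ≈ h ∘ k
  pullʳ p = trans assoc (∘-congˡ p)

  cancelˡ : f ∘ g ≈ k → f ∘ (g ∘ h) ≈ k ∘ h
  cancelˡ p = trans (sym assoc) (∘-congʳ p)

  ⁂∘⟨⟩ : (f ⁂ g) ∘ ⟨ h , k ⟩ ≈ ⟨ f ∘ h , g ∘ k ⟩
  ⁂∘⟨⟩ = trans ⟨⟩∘ (⟨⟩-cong (pullʳ project₁) (pullʳ project₂))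

  cast-trans : (p : A ≡ B) (q : B ≡ C) →
               cast (≡.trans p q) ≈ cast q ∘ cast p
  cast-trans ≡.refl q = sym identityʳ

  cast-×ʳ : (p : A ≡ B) → cast (≡.cong (_× C) p) ≈ cast p ⁂ id
  cast-×ʳ ≡.refl = sym (unique (trans identityʳ (sym identityˡ))
                                (trans identityʳ (sym identityˡ)))

  cast-inverseˡ : (p : A ≡ B) → cast (≡.sym p) ∘ cast p ≈ id
  cast-inverseˡ ≡.refl = identityˡ

  cast-inverseʳ : (p : A ≡ B) → cast p ∘ cast (≡.sym p) ≈ id
  cast-inverseʳ ≡.refl = identityˡ

  cast-sym : (p : A ≡ B) {f : B ⇒ A} → cast p ∘ f ≈ id → cast (≡.sym p) ≈ f
  cast-sym p {f} eq = begin
    cast (≡.sym p)                ≈⟨ identityʳ ⟨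
    cast (≡.sym p) ∘ id           ≈⟨ ∘-congˡ eq ⟨
    cast (≡.sym p) ∘ (cast p ∘ f) ≈⟨ cancelˡ (cast-inverseˡ p) ⟩
    id ∘ f                        ≈⟨ identityˡ ⟩
    f                             ∎

  subst₂-cast : (p : A ≡ B) (q : C ≡ D) (f : A ⇒ C) →
                subst₂ _⇒_ p q f ≈ cast q ∘ (f ∘ cast (≡.sym p))
  subst₂-cast ≡.refl ≡.refl f = trans (sym identityʳ) (sym identityˡ)

  subst₂-sym-cast : (p : A ≡ B) (q : C ≡ D) (f : B ⇒ D) →
                    subst₂ _⇒_ (≡.sym p) (≡.sym q) f
                      ≈ cast (≡.sym q) ∘ (f ∘ cast p)
  subst₂-sym-cast ≡.refl ≡.refl f = trans (sym identityʳ) (sym identityˡ)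

module StCategory {o ℓ e} (ℂ : StrictCartesianCategory o ℓ e) where
  open StrictCartesianCategory ℂ
  open StatefulMorphisms ℂ
  open CartesianProperties cartesian
  open Equiv
  open HomReasoning

  private variable
    S S′ S″ T T′ A B C D V W Z : Obj
    X Y : ObjSeq

  -- Each 2-cell operation, evaluated on generalized elements.

  ✶-apply : (g : TwoCell T B T′ C) (f : TwoCell S A S′ B)
            {s : Z ⇒ S} {t : Z ⇒ T} {x : Z ⇒ A} →
            let s′y = U f ∘ ⟨ s , x ⟩
                t′z = U g ∘ ⟨ t , π₂ ∘ s′y ⟩ in
            U (g ✶ f) ∘ ⟨ ⟨ s , t ⟩ , x ⟩
              ≈ ⟨ ⟨ π₁ ∘ s′y , π₁ ∘ t′z ⟩ , π₂ ∘ t′z ⟩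
  ✶-apply g f =
    trans ⟨⟩∘ (⟨⟩-cong (trans ⟨⟩∘ (⟨⟩-cong (pullʳ eq₁) (pullʳ eq₂)))
                       (pullʳ eq₂))
    where
    eq₁ = pullʳ (trans ⟨⟩∘ (⟨⟩-cong (trans (pullʳ project₁) project₁) project₂))
    eq₂ = pullʳ (trans ⟨⟩∘ (⟨⟩-cong (trans (pullʳ project₁) project₂)
                                    (pullʳ eq₁)))

  ；-apply : (f : TwoCell S A S′ B) (h : TwoCell S′ V S″ W)
            {s : Z ⇒ S} {x : Z ⇒ A} {v : Z ⇒ V} →
            let s′y = U f ∘ ⟨ s , x ⟩
                s″w = U h ∘ ⟨ π₁ ∘ s′y , v ⟩ in
            U (f ； h) ∘ ⟨ s , ⟨ x , v ⟩ ⟩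
              ≈ ⟨ π₁ ∘ s″w , ⟨ π₂ ∘ s′y , π₂ ∘ s″w ⟩ ⟩
  ；-apply f h =
    trans ⟨⟩∘ (⟨⟩-cong (pullʳ eq₂)
                       (trans ⟨⟩∘ (⟨⟩-cong (pullʳ eq₁) (pullʳ eq₂))))
    where
    eq₁ = pullʳ (trans ⟨⟩∘ (⟨⟩-cong project₁ (trans (pullʳ project₂) project₁)))
    eq₂ = pullʳ (trans ⟨⟩∘ (⟨⟩-cong (pullʳ eq₁)
                                    (trans (pullʳ project₂) project₂)))

  pairCell-apply : (f : TwoCell S A S′ B) (g : TwoCell T A T′ C)
                   {s : Z ⇒ S} {t : Z ⇒ T} {x : Z ⇒ A} →
                   let s′y = U f ∘ ⟨ s , x ⟩
                       t′z = U g ∘ ⟨ t , x ⟩ in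
                   U (pairCell f g) ∘ ⟨ ⟨ s , t ⟩ , x ⟩
                     ≈ ⟨ ⟨ π₁ ∘ s′y , π₁ ∘ t′z ⟩ , ⟨ π₂ ∘ s′y , π₂ ∘ t′z ⟩ ⟩
  pairCell-apply f g =
    trans ⟨⟩∘ (⟨⟩-cong (trans ⟨⟩∘ (⟨⟩-cong (pullʳ eq₁) (pullʳ eq₂)))
                       (trans ⟨⟩∘ (⟨⟩-cong (pullʳ eq₁) (pullʳ eq₂))))
    where
    eq₁ = pullʳ (trans ⟨⟩∘ (⟨⟩-cong (trans (pullʳ project₁) project₁) project₂))
    eq₂ = pullʳ (trans ⟨⟩∘ (⟨⟩-cong (trans (pullʳ project₁) project₂) project₂))

  ʰ-apply : (φ : A ⇒ B) {s : Z ⇒ ⊤} {x : Z ⇒ A} →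
            U (φ ʰ) ∘ ⟨ s , x ⟩ ≈ ⟨ ! , φ ∘ x ⟩
  ʰ-apply {A} {B} φ {s} {x} = begin
    U (φ ʰ) ∘ ⟨ s , x ⟩
      ≈⟨ ∘-congʳ (subst₂-sym-cast (×-unitˡ A) (×-unitˡ B) φ) ⟩
    (cast (≡.sym (×-unitˡ B)) ∘ (φ ∘ cast (×-unitˡ A))) ∘ ⟨ s , x ⟩
      ≈⟨ pullʳ (pullʳ (trans (∘-congʳ (cast-unitˡ A)) project₂)) ⟩
    cast (≡.sym (×-unitˡ B)) ∘ (φ ∘ x)
      ≈⟨ ∘-congʳ (cast-sym (×-unitˡ B) (trans (∘-congʳ (cast-unitˡ B)) project₂)) ⟩
    ⟨ ! , id ⟩ ∘ (φ ∘ x)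
      ≈⟨ trans ⟨⟩∘ (⟨⟩-cong !-unique₂ identityˡ) ⟩
    ⟨ ! , φ ∘ x ⟩ ∎

  ᵛ-apply : (φ : A ⇒ B) {s : Z ⇒ A} {x : Z ⇒ ⊤} →
            U (φ ᵛ) ∘ ⟨ s , x ⟩ ≈ ⟨ φ ∘ s , ! ⟩
  ᵛ-apply {A} {B} φ {s} {x} = begin
    U (φ ᵛ) ∘ ⟨ s , x ⟩
      ≈⟨ ∘-congʳ (subst₂-sym-cast (×-unitʳ A) (×-unitʳ B) φ) ⟩
    (cast (≡.sym (×-unitʳ B)) ∘ (φ ∘ cast (×-unitʳ A))) ∘ ⟨ s , x ⟩
      ≈⟨ pullʳ (pullʳ (trans (∘-congʳ (cast-unitʳ A)) project₁)) ⟩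
    cast (≡.sym (×-unitʳ B)) ∘ (φ ∘ s)
      ≈⟨ ∘-congʳ (cast-sym (×-unitʳ B) (trans (∘-congʳ (cast-unitʳ B)) project₁)) ⟩
    ⟨ id , ! ⟩ ∘ (φ ∘ s)
      ≈⟨ trans ⟨⟩∘ (⟨⟩-cong identityˡ !-unique₂) ⟩
    ⟨ φ ∘ s , ! ⟩ ∎

  -- The output at time n as a function of the inputs up to time n; the
  -- truncations are determined by these outputs and conversely.

  last : ∀ X n → ∏ X n ⇒ X n
  last X zero      = id
  last X (suc n) = π₂

  module _ {X Y : ObjSeq} where

    before : (f : Stateful X Y) (n : ℕ) → ∏ X n ⇒ state f n
    reach  : (f : Stateful X Y) (n : ℕ) → ∏ X n ⇒ state f (suc n) × Y n
    before f zero      = init f ∘ !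
    before f (suc n) = (π₁ ∘ reach f n) ∘ π₁
    reach f n = U (cells f n) ∘ ⟨ before f n , last X n ⟩

    out : (f : Stateful X Y) (n : ℕ) → ∏ X n ⇒ Y n
    out f n = π₂ ∘ reach f n

    outs : (f : Stateful X Y) (n : ℕ) → ∏ X n ⇒ ∏ Y n
    outs f zero      = out f 0
    outs f (suc n) = ⟨ outs f n ∘ π₁ , out f (suc n) ⟩

    last-outs : ∀ f n → last Y n ∘ outs f n ≈ out f n
    last-outs f zero      = identityˡ
    last-outs f (suc n) = project₂

  add⊤ : ∀ X n → ∏ X n ⇒ ⊤×∏ X n
  add⊤ X zero      = ⟨ ! , id ⟩
  add⊤ X (suc n) = ⟨ add⊤ X n ∘ π₁ , π₂ ⟩

  cast-add⊤ : ∀ X n → cast (⊤×∏≡∏ X n) ∘ add⊤ X n ≈ id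
  cast-add⊤ X zero = trans (∘-congʳ (cast-unitˡ (X 0))) project₂
  cast-add⊤ X (suc n) = begin
    cast (⊤×∏≡∏ X (suc n)) ∘ ⟨ add⊤ X n ∘ π₁ , π₂ ⟩
      ≈⟨ trans (∘-congʳ (cast-×ʳ (⊤×∏≡∏ X n))) ⁂∘⟨⟩ ⟩
    ⟨ cast (⊤×∏≡∏ X n) ∘ (add⊤ X n ∘ π₁) , id ∘ π₂ ⟩
      ≈⟨ unique (trans identityʳ (sym (trans (cancelˡ (cast-add⊤ X n)) identityˡ)))
                (trans identityʳ (sym identityˡ)) ⟩
    id ∎

  cast-boundary : ∀ Z n → cast (boundary≡∏ Z n)
                          ≈ cast (⊤×∏≡∏ Z n) ∘ (π₁ ∘ π₂)
  cast-boundary Z n = begin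
    cast (boundary≡∏ Z n)
      ≈⟨ cast-trans (×-unitˡ _) _ ⟩
    cast (≡.trans (×-unitʳ _) (⊤×∏≡∏ Z n)) ∘ cast (×-unitˡ _)
      ≈⟨ ∘-cong (cast-trans (×-unitʳ _) _) (cast-unitˡ _) ⟩
    (cast (⊤×∏≡∏ Z n) ∘ cast (×-unitʳ _)) ∘ π₂
      ≈⟨ pullʳ (∘-congʳ (cast-unitʳ _)) ⟩
    cast (⊤×∏≡∏ Z n) ∘ (π₁ ∘ π₂) ∎

  module _ {X Y : ObjSeq} where

    unroll-reach : (f : Stateful X Y) (n : ℕ) →
      U (unroll f n) ∘ ⟨ ! , add⊤ X n ⟩
        ≈ ⟨ π₁ ∘ reach f n , add⊤ Y n ∘ outs f n ⟩
    unroll-reach f zero = begin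
      U (unroll f 0) ∘ ⟨ ! , ⟨ ! , id ⟩ ⟩
        ≈⟨ ；-apply (init f ᵛ) (cells f 0) ⟩
      ⟨ π₁ ∘ s″w , ⟨ π₂ ∘ s′y , π₂ ∘ s″w ⟩ ⟩
        ≈⟨ ⟨⟩-cong (∘-congˡ eq) (⟨⟩-cong !-unique₂ (∘-congˡ eq)) ⟩
      ⟨ π₁ ∘ reach f 0 , ⟨ ! ∘ out f 0 , out f 0 ⟩ ⟩
        ≈⟨ ⟨⟩-cong refl (trans ⟨⟩∘ (⟨⟩-cong refl identityˡ)) ⟨
      ⟨ π₁ ∘ reach f 0 , ⟨ ! , id ⟩ ∘ out f 0 ⟩ ∎
      where
      s′y = U (init f ᵛ) ∘ ⟨ ! , ! ⟩
      s″w = U (cells f 0) ∘ ⟨ π₁ ∘ s′y , id ⟩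
      eq : s″w ≈ reach f 0
      eq = ∘-congˡ (⟨⟩-cong (trans (∘-congˡ (ᵛ-apply (init f))) project₁) refl)
    unroll-reach f (suc n) = begin
      U (unroll f (suc n)) ∘ ⟨ ! , ⟨ add⊤ X n ∘ π₁ , π₂ ⟩ ⟩
        ≈⟨ ；-apply (unroll f n) (cells f (suc n)) ⟩
      ⟨ π₁ ∘ s″w , ⟨ π₂ ∘ s′y , π₂ ∘ s″w ⟩ ⟩
        ≈⟨ ⟨⟩-cong (∘-congˡ eq₂)
             (⟨⟩-cong (trans (∘-congˡ eq₁) project₂) (∘-congˡ eq₂)) ⟩
      ⟨ π₁ ∘ reach f (suc n) ,
        ⟨ (add⊤ Y n ∘ outs f n) ∘ π₁ , out f (suc n) ⟩ ⟩
        ≈⟨ ⟨⟩-cong refl (trans ⟨⟩∘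
             (⟨⟩-cong (trans (pullʳ project₁) (sym assoc)) project₂)) ⟨
      ⟨ π₁ ∘ reach f (suc n) , add⊤ Y (suc n) ∘ outs f (suc n) ⟩ ∎
      where
      s′y = U (unroll f n) ∘ ⟨ ! , add⊤ X n ∘ π₁ ⟩
      s″w = U (cells f (suc n)) ∘ ⟨ π₁ ∘ s′y , π₂ ⟩
      eq₁ : s′y ≈ ⟨ (π₁ ∘ reach f n) ∘ π₁ , (add⊤ Y n ∘ outs f n) ∘ π₁ ⟩
      eq₁ = begin
        s′y
          ≈⟨ ∘-congˡ (trans ⟨⟩∘ (⟨⟩-cong !-unique₂ refl)) ⟨
        U (unroll f n) ∘ (⟨ ! , add⊤ X n ⟩ ∘ π₁)
          ≈⟨ cancelˡ (unroll-reach f n) ⟩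
        ⟨ π₁ ∘ reach f n , add⊤ Y n ∘ outs f n ⟩ ∘ π₁
          ≈⟨ ⟨⟩∘ ⟩
        ⟨ (π₁ ∘ reach f n) ∘ π₁ , (add⊤ Y n ∘ outs f n) ∘ π₁ ⟩ ∎
      eq₂ : s″w ≈ reach f (suc n)
      eq₂ = ∘-congˡ (⟨⟩-cong (trans (∘-congˡ eq₁) project₁) refl)

    Tc≈outs : (f : Stateful X Y) (n : ℕ) → Tc n f ≈ outs f n
    Tc≈outs f n = begin
      Tc n f
        ≈⟨ subst₂-cast (boundary≡∏ X n) (boundary≡∏ Y n) _ ⟩
      cast (boundary≡∏ Y n) ∘ (U c ∘ cast (≡.sym (boundary≡∏ X n)))
        ≈⟨ ∘-congˡ (∘-congˡ (cast-sym (boundary≡∏ X n) section)) ⟩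
      cast (boundary≡∏ Y n) ∘ (U c ∘ ⟨ ! , ⟨ add⊤ X n , ! ⟩ ⟩)
        ≈⟨ ∘-cong (cast-boundary Y n) (；-apply (unroll f n) (! ᵛ)) ⟩
      (cast (⊤×∏≡∏ Y n) ∘ (π₁ ∘ π₂)) ∘ ⟨ _ , ⟨ π₂ ∘ s′y , _ ⟩ ⟩
        ≈⟨ pullʳ (trans (pullʳ project₂) project₁) ⟩
      cast (⊤×∏≡∏ Y n) ∘ (π₂ ∘ s′y)
        ≈⟨ ∘-congˡ (trans (∘-congˡ (unroll-reach f n)) project₂) ⟩
      cast (⊤×∏≡∏ Y n) ∘ (add⊤ Y n ∘ outs f n)
        ≈⟨ trans (cancelˡ (cast-add⊤ Y n)) identityˡ ⟩
      outs f n ∎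
      where
      c = unroll f n ； ! ᵛ
      s′y = U (unroll f n) ∘ ⟨ ! , add⊤ X n ⟩
      section : cast (boundary≡∏ X n) ∘ ⟨ ! , ⟨ add⊤ X n , ! ⟩ ⟩ ≈ id
      section = trans (∘-congʳ (cast-boundary X n))
                  (trans (pullʳ (trans (pullʳ project₂) project₁))
                         (cast-add⊤ X n))

    outs-cong : {f g : Stateful X Y} →
                (∀ n → out f n ≈ out g n) → ∀ n → outs f n ≈ outs g n
    outs-cong p zero      = p 0
    outs-cong p (suc n) = ⟨⟩-cong (∘-congʳ (outs-cong p n)) (p (suc n))

    out⇒≈ˢ : {f g : Stateful X Y} → (∀ n → out f n ≈ out g n) → f ≈ˢ g
    out⇒≈ˢ {f} {g} p n =
      trans (Tc≈outs f n)
        (trans (outs-cong {f} {g} p n) (sym (Tc≈outs g n)))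

    ≈ˢ⇒outs : {f g : Stateful X Y} → f ≈ˢ g → ∀ n → outs f n ≈ outs g n
    ≈ˢ⇒outs {f} {g} p n =
      trans (sym (Tc≈outs f n)) (trans (p n) (Tc≈outs g n))

    ≈ˢ⇒out : {f g : Stateful X Y} → f ≈ˢ g → ∀ n → out f n ≈ out g n
    ≈ˢ⇒out {f} {g} p n =
      trans (sym (last-outs f n))
        (trans (∘-congˡ (≈ˢ⇒outs {f} {g} p n)) (last-outs g n))

  out-pure : (φ : ∀ k → X k ⇒ Y k) (n : ℕ) → out (pure φ) n ≈ φ n ∘ last X n
  out-pure φ n = trans (∘-congˡ (ʰ-apply (φ n))) project₂

  out-id : ∀ n → out (idˢ {X}) n ≈ last X n
  out-id {X} n = trans (out-pure (λ k → id {X k}) n) identityˡ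

  outs-id : ∀ n → outs (idˢ {X}) n ≈ id
  outs-id {X} zero = out-id {X} 0
  outs-id {X} (suc n) =
    unique (trans identityʳ (sym (trans (∘-congʳ (outs-id {X} n)) identityˡ)))
           (trans identityʳ (sym (out-id {X} (suc n))))

  module _ {X Y Z : ObjSeq} (f : Stateful Y Z) (g : Stateful X Y) where

    before-∘ : ∀ n → before (f ∘ˢ g) n ≈ ⟨ before g n , before f n ∘ outs g n ⟩
    reach-∘  : ∀ n → let r = reach f n ∘ outs g n in
               reach (f ∘ˢ g) n ≈ ⟨ ⟨ π₁ ∘ reach g n , π₁ ∘ r ⟩ , π₂ ∘ r ⟩
    before-∘ zero = trans ⟨⟩∘ (⟨⟩-cong refl (sym (pullʳ !-unique₂)))
    before-∘ (suc n) = begin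
      (π₁ ∘ reach (f ∘ˢ g) n) ∘ π₁
        ≈⟨ ∘-congʳ (trans (∘-congˡ (reach-∘ n)) project₁) ⟩
      ⟨ π₁ ∘ reach g n , π₁ ∘ (reach f n ∘ outs g n) ⟩ ∘ π₁
        ≈⟨ ⟨⟩∘ ⟩
      ⟨ before g (suc n) , (π₁ ∘ (reach f n ∘ outs g n)) ∘ π₁ ⟩
        ≈⟨ ⟨⟩-cong refl (∘-congʳ (sym assoc)) ⟩
      ⟨ before g (suc n) , ((π₁ ∘ reach f n) ∘ outs g n) ∘ π₁ ⟩
        ≈⟨ ⟨⟩-cong refl (trans (pullʳ project₁) (sym assoc)) ⟨
      ⟨ before g (suc n) , before f (suc n) ∘ outs g (suc n) ⟩ ∎
    reach-∘ n = begin
      U (cells f n ✶ cells g n) ∘ ⟨ before (f ∘ˢ g) n , last X n ⟩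
        ≈⟨ ∘-congˡ (⟨⟩-cong (before-∘ n) refl) ⟩
      U (cells f n ✶ cells g n)
        ∘ ⟨ ⟨ before g n , before f n ∘ outs g n ⟩ , last X n ⟩
        ≈⟨ ✶-apply (cells f n) (cells g n) ⟩
      ⟨ ⟨ π₁ ∘ reach g n , π₁ ∘ t′z ⟩ , π₂ ∘ t′z ⟩
        ≈⟨ ⟨⟩-cong (⟨⟩-cong refl (∘-congˡ eq)) (∘-congˡ eq) ⟩
      ⟨ ⟨ π₁ ∘ reach g n , π₁ ∘ (reach f n ∘ outs g n) ⟩
      , π₂ ∘ (reach f n ∘ outs g n) ⟩ ∎
      where
      t′z = U (cells f n) ∘ ⟨ before f n ∘ outs g n , out g n ⟩
      eq : t′z ≈ reach f n ∘ outs g n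
      eq = sym (pullʳ (trans ⟨⟩∘ (⟨⟩-cong refl (last-outs g n))))

    out-∘ : ∀ n → out (f ∘ˢ g) n ≈ out f n ∘ outs g n
    out-∘ n = trans (∘-congˡ (reach-∘ n)) (trans project₂ (sym assoc))

    outs-∘ : ∀ n → outs (f ∘ˢ g) n ≈ outs f n ∘ outs g n
    outs-∘ zero      = out-∘ 0
    outs-∘ (suc n) = begin
      ⟨ outs (f ∘ˢ g) n ∘ π₁ , out (f ∘ˢ g) (suc n) ⟩
        ≈⟨ ⟨⟩-cong (trans (∘-congʳ (outs-∘ n)) assoc) (out-∘ (suc n)) ⟩
      ⟨ outs f n ∘ (outs g n ∘ π₁) , out f (suc n) ∘ outs g (suc n) ⟩
        ≈⟨ trans ⟨⟩∘ (⟨⟩-cong (pullʳ project₁) refl) ⟨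
      outs f (suc n) ∘ outs g (suc n) ∎

  module _ {X Y Z : ObjSeq} (f : Stateful X Y) (g : Stateful X Z) where

    before-⟨⟩ : ∀ n → before ⟨ f , g ⟩ˢ n ≈ ⟨ before f n , before g n ⟩
    reach-⟨⟩  : ∀ n → reach ⟨ f , g ⟩ˢ n ≈
                ⟨ ⟨ π₁ ∘ reach f n , π₁ ∘ reach g n ⟩ , ⟨ out f n , out g n ⟩ ⟩
    before-⟨⟩ zero      = ⟨⟩∘
    before-⟨⟩ (suc n) =
      trans (∘-congʳ (trans (∘-congˡ (reach-⟨⟩ n)) project₁)) ⟨⟩∘
    reach-⟨⟩ n = trans (∘-congˡ (⟨⟩-cong (before-⟨⟩ n) refl))
                       (pairCell-apply (cells f n) (cells g n))

    out-⟨⟩ : ∀ n → out ⟨ f , g ⟩ˢ n ≈ ⟨ out f n , out g n ⟩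
    out-⟨⟩ n = trans (∘-congˡ (reach-⟨⟩ n)) project₂

  out-pure-∘ : ∀ {X Y Z : ObjSeq} (φ : ∀ k → Y k ⇒ Z k)
               (f : Stateful X Y) (n : ℕ) →
               out (pure φ ∘ˢ f) n ≈ φ n ∘ out f n
  out-pure-∘ φ f n =
    trans (out-∘ (pure φ) f n)
      (trans (∘-congʳ (out-pure φ n)) (pullʳ (last-outs f n)))

  St : CartesianCategory o (o ⊔ ℓ) e
  St = record
    { Obj = ObjSeq
    ; _⇒_ = Stateful
    ; _≈_ = _≈ˢ_
    ; id  = idˢ
    ; _∘_ = _∘ˢ_
    ; isEquivalence = record
      { refl  = λ _ → refl
      ; sym   = λ p n → sym (p n)
      ; trans = λ p q n → trans (p n) (q n)
      }
    ; ∘-cong = λ {_} {_} {_} {f} {f′} {g} {g′} p q →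
        out⇒≈ˢ {f = f ∘ˢ g} {g = f′ ∘ˢ g′} λ n →
          trans (out-∘ f g n)
            (trans (∘-cong (≈ˢ⇒out {f = f} {g = f′} p n)
                           (≈ˢ⇒outs {f = g} {g = g′} q n))
                   (sym (out-∘ f′ g′ n)))
    ; assoc = λ {_} {_} {_} {_} {f} {g} {h} →
        out⇒≈ˢ {f = (h ∘ˢ g) ∘ˢ f} {g = h ∘ˢ (g ∘ˢ f)} λ n →
          trans (out-∘ (h ∘ˢ g) f n)
            (trans (∘-congʳ (out-∘ h g n))
              (trans (pullʳ (sym (outs-∘ g f n))) (sym (out-∘ h (g ∘ˢ f) n))))
    ; identityˡ = λ {_} {B} {f} → out⇒≈ˢ {f = idˢ ∘ˢ f} {g = f} λ n →
        trans (out-pure-∘ (λ k → id {B k}) f n) identityˡ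
    ; identityʳ = λ {A} {_} {f} → out⇒≈ˢ {f = f ∘ˢ idˢ} {g = f} λ n →
        trans (out-∘ f idˢ n) (trans (∘-congˡ (outs-id {A} n)) identityʳ)
    ; ⊤ = λ _ → ⊤
    ; ! = pure (λ _ → !)
    ; !-unique = λ f → out⇒≈ˢ {f = pure (λ _ → !)} {g = f} λ n → !-unique₂
    ; _×_ = _×ˢ_
    ; π₁ = pure (λ _ → π₁)
    ; π₂ = pure (λ _ → π₂)
    ; ⟨_,_⟩ = ⟨_,_⟩ˢ
    ; project₁ = λ {A} {B} {_} {f} {g} →
        out⇒≈ˢ {f = pure (λ k → π₁ {A k} {B k}) ∘ˢ ⟨ f , g ⟩ˢ} {g = f} λ n →
          trans (out-pure-∘ (λ k → π₁ {A k} {B k}) ⟨ f , g ⟩ˢ n)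
            (trans (∘-congˡ (out-⟨⟩ f g n)) project₁)
    ; project₂ = λ {A} {B} {_} {f} {g} →
        out⇒≈ˢ {f = pure (λ k → π₂ {A k} {B k}) ∘ˢ ⟨ f , g ⟩ˢ} {g = g} λ n →
          trans (out-pure-∘ (λ k → π₂ {A k} {B k}) ⟨ f , g ⟩ˢ n)
            (trans (∘-congˡ (out-⟨⟩ f g n)) project₂)
    ; unique = λ {A} {B} {_} {h} {f} {g} p q →
        out⇒≈ˢ {f = ⟨ f , g ⟩ˢ} {g = h} λ n →
          trans (out-⟨⟩ f g n)
            (unique
              (trans (sym (out-pure-∘ (λ k → π₁ {A k} {B k}) h n))
                     (≈ˢ⇒out {f = pure (λ k → π₁ {A k} {B k}) ∘ˢ h} {g = f} p n))
              (trans (sym (out-pure-∘ (λ k → π₂ {A k} {B k}) h n))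
                     (≈ˢ⇒out {f = pure (λ k → π₂ {A k} {B k}) ∘ˢ h} {g = g} q n)))
    }

open StCategory public using (St)

module DelayedTrace {o ℓ e} (ℂ : StrictCartesianCategory o ℓ e) where
  open StrictCartesianCategory ℂ public
  open StatefulMorphisms ℂ public
    using (ObjSeq; ○; U; state; init; cells; tail; tr)
  open CartesianCategory (St ℂ) public using () renaming
    ( _⇒_ to _⇒ˢ_ ; _≈_ to _≈ˢ_ ; _∘_ to _∘ˢ_ ; id to idˢ
    ; _×_ to _×ˢ_ ; _⁂_ to _⁂ˢ_ )

{-# OPTIONS --safe #-}

-- Sliding g around the feedback loop amounts to advancing it by half a step.
-- Run both traces on the same inputs: if g holds state a and is about to read
-- v on the left, then on the right it has already turned (a, v) into (c, t)
-- and t is what is being fed back, while s is in the same state on both sides.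
-- This relation between the two composite states holds initially by the choice
-- of (j′, u′), is preserved by every cell, and forces equal outputs.

module Submission where

open import Level using (_⊔_)
open import Data.Nat.Base using (ℕ; zero; suc)
import Relation.Binary.PropositionalEquality.Core as ≡
open import Defs

module Sliding {o ℓ e} (ℂ : StrictCartesianCategory o ℓ e) where
  open StrictCartesianCategory ℂ
  open StatefulMorphisms ℂ
  open CartesianProperties cartesian
  open StCategory ℂ hiding (St)
  open Equiv
  open HomReasoning

  private variable
    A B C G G′ G″ S S′ T T′ V V′ W X Y Z : Obj

  π₁-pair : {p : Z ⇒ A × B} {f : Z ⇒ A} {g : Z ⇒ B} →
            p ≈ ⟨ f , g ⟩ → π₁ ∘ p ≈ f
  π₁-pair eq = trans (∘-congˡ eq) project₁

  π₂-pair : {p : Z ⇒ A × B} {f : Z ⇒ A} {g : Z ⇒ B} →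
            p ≈ ⟨ f , g ⟩ → π₂ ∘ p ≈ g
  π₂-pair eq = trans (∘-congˡ eq) project₂

  assoc-apply : {a : Z ⇒ A} {b : Z ⇒ B} {c : Z ⇒ C} →
                cast (×-assoc A B C) ∘ ⟨ ⟨ a , b ⟩ , c ⟩ ≈ ⟨ a , ⟨ b , c ⟩ ⟩
  assoc-apply =
    trans (∘-congʳ (cast-assoc _ _ _))
      (trans ⟨⟩∘
        (⟨⟩-cong (trans (pullʳ project₁) project₁)
          (trans ⟨⟩∘ (⟨⟩-cong (trans (pullʳ project₁) project₂) project₂))))

  assoc⁻¹-apply : {a : Z ⇒ A} {b : Z ⇒ B} {c : Z ⇒ C} →
                  cast (≡.sym (×-assoc A B C)) ∘ ⟨ a , ⟨ b , c ⟩ ⟩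
                    ≈ ⟨ ⟨ a , b ⟩ , c ⟩
  assoc⁻¹-apply =
    trans (∘-congˡ (sym assoc-apply))
      (trans (cancelˡ (cast-inverseˡ (×-assoc _ _ _))) identityˡ)

  -- By `cast-assoc`, transport along `×-assoc` is rebracketing, so the conversion only regroups
  -- tuples. Here and in the other `-eval` lemmas, results of the constituent maps enter as premises
  -- with named components, so that evaluations of nested composites chain.
  ⌊⌉-eval : (f : TwoCell S (T × X) S′ (T′ × Y))
            {s : Z ⇒ S} {t : Z ⇒ T} {x : Z ⇒ X}
            {s′ : Z ⇒ S′} {t′ : Z ⇒ T′} {y : Z ⇒ Y} →
            U f ∘ ⟨ s , ⟨ t , x ⟩ ⟩ ≈ ⟨ s′ , ⟨ t′ , y ⟩ ⟩ →
            U ⌊ f ⌉ ∘ ⟨ ⟨ s , t ⟩ , x ⟩ ≈ ⟨ ⟨ s′ , t′ ⟩ , y ⟩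
  ⌊⌉-eval f eq =
    trans (∘-congʳ (subst₂-sym-cast (×-assoc _ _ _) (×-assoc _ _ _) (U f)))
      (trans (pullʳ (trans (pullʳ assoc-apply) eq)) assoc⁻¹-apply)

  ✶-eval : (g : TwoCell T B T′ C) (f : TwoCell S A S′ B)
           {s : Z ⇒ S} {t : Z ⇒ T} {x : Z ⇒ A}
           {s′ : Z ⇒ S′} {y : Z ⇒ B} {t′ : Z ⇒ T′} {z : Z ⇒ C} →
           U f ∘ ⟨ s , x ⟩ ≈ ⟨ s′ , y ⟩ → U g ∘ ⟨ t , y ⟩ ≈ ⟨ t′ , z ⟩ →
           U (g ✶ f) ∘ ⟨ ⟨ s , t ⟩ , x ⟩ ≈ ⟨ ⟨ s′ , t′ ⟩ , z ⟩
  ✶-eval g f eq-f eq-g =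
    trans (✶-apply g f)
      (⟨⟩-cong (⟨⟩-cong (π₁-pair eq-f) (π₁-pair eq)) (π₂-pair eq))
    where
    eq = trans (∘-congˡ (⟨⟩-cong refl (π₂-pair eq-f))) eq-g

  pairCell-eval : (f : TwoCell S A S′ B) (g : TwoCell T A T′ C)
                  {s : Z ⇒ S} {t : Z ⇒ T} {x : Z ⇒ A}
                  {s′ : Z ⇒ S′} {y : Z ⇒ B} {t′ : Z ⇒ T′} {z : Z ⇒ C} →
                  U f ∘ ⟨ s , x ⟩ ≈ ⟨ s′ , y ⟩ → U g ∘ ⟨ t , x ⟩ ≈ ⟨ t′ , z ⟩ →
                  U (pairCell f g) ∘ ⟨ ⟨ s , t ⟩ , x ⟩
                    ≈ ⟨ ⟨ s′ , t′ ⟩ , ⟨ y , z ⟩ ⟩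
  pairCell-eval f g eq-f eq-g =
    trans (pairCell-apply f g)
      (⟨⟩-cong (⟨⟩-cong (π₁-pair eq-f) (π₁-pair eq-g))
               (⟨⟩-cong (π₂-pair eq-f) (π₂-pair eq-g)))

  ʰ-eval : (φ : A ⇒ B) {x : Z ⇒ A} {y : Z ⇒ B} →
           φ ∘ x ≈ y → U (φ ʰ) ∘ ⟨ ! , x ⟩ ≈ ⟨ ! , y ⟩
  ʰ-eval φ eq = trans (ʰ-apply φ) (⟨⟩-cong refl eq)

  -- The cells of g ⁂ id in St(ℂ); the identity and the projections contribute
  -- the unit state factors.
  _⊗id : TwoCell G V G′ T → TwoCell ((⊤ × G) × (⊤ × ⊤)) (V × X)
                                    ((⊤ × G′) × (⊤ × ⊤)) (T × X)
  g ⊗id = pairCell (g ✶ (π₁ ʰ)) ((id ʰ) ✶ (π₂ ʰ))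

  -- Maps into `⊤` are unique, so `a` is all the information such a state carries; this fixes one
  -- representative.
  pad : Z ⇒ G → Z ⇒ (⊤ × G) × (⊤ × ⊤)
  pad a = ⟨ ⟨ ! , a ⟩ , ⟨ ! , ! ⟩ ⟩

  pad-∘ : {p q r : W ⇒ ⊤} {a : W ⇒ G} {z : Z ⇒ W} →
          ⟨ ⟨ p , a ⟩ , ⟨ q , r ⟩ ⟩ ∘ z ≈ pad (a ∘ z)
  pad-∘ = trans ⟨⟩∘
            (⟨⟩-cong (trans ⟨⟩∘ (⟨⟩-cong !-unique₂ refl))
                     (trans ⟨⟩∘ (⟨⟩-cong !-unique₂ !-unique₂)))

  ⊗id-eval : (g : TwoCell G V G′ T)
             {a : Z ⇒ G} {v : Z ⇒ V} {x : Z ⇒ X} {c : Z ⇒ G′} {t : Z ⇒ T} →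
             U g ∘ ⟨ a , v ⟩ ≈ ⟨ c , t ⟩ →
             U (g ⊗id) ∘ ⟨ pad a , ⟨ v , x ⟩ ⟩ ≈ ⟨ pad c , ⟨ t , x ⟩ ⟩
  ⊗id-eval g eq =
    pairCell-eval (g ✶ (π₁ ʰ)) ((id ʰ) ✶ (π₂ ʰ))
      (✶-eval g (π₁ ʰ) (ʰ-eval π₁ project₁) eq)
      (✶-eval (id ʰ) (π₂ ʰ) (ʰ-eval π₂ project₂) (ʰ-eval id identityˡ))

  -- The factors are permuted because composition puts the state of the morphism applied first in
  -- front; the traced value comes last.
  record Linked (g : TwoCell G V G′ T)
                (l : Z ⇒ (((⊤ × G) × (⊤ × ⊤)) × S) × V)
                (r : Z ⇒ (S × ((⊤ × G′) × (⊤ × ⊤))) × T) : Set (ℓ ⊔ e) where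
    field
      {a} : Z ⇒ G
      {b} : Z ⇒ S
      {v} : Z ⇒ V
      {c} : Z ⇒ G′
      {t} : Z ⇒ T
      left   : l ≈ ⟨ ⟨ pad a , b ⟩ , v ⟩
      right  : r ≈ ⟨ ⟨ b , pad c ⟩ , t ⟩
      g-step : U g ∘ ⟨ a , v ⟩ ≈ ⟨ c , t ⟩

  -- Carries the relation to a longer input history: `before` is precomposed with `π₁` at a
  -- successor and with `!` at zero.
  Linked-∘ : {g : TwoCell G V G′ T}
             {l : W ⇒ (((⊤ × G) × (⊤ × ⊤)) × S) × V}
             {r : W ⇒ (S × ((⊤ × G′) × (⊤ × ⊤))) × T} →
             Linked g l r → (z : Z ⇒ W) → Linked g (l ∘ z) (r ∘ z)
  Linked-∘ linked z = record
    { left   = trans (∘-congʳ left)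
                 (trans ⟨⟩∘ (⟨⟩-cong (trans ⟨⟩∘ (⟨⟩-cong pad-∘ refl)) refl))
    ; right  = trans (∘-congʳ right)
                 (trans ⟨⟩∘ (⟨⟩-cong (trans ⟨⟩∘ (⟨⟩-cong refl pad-∘)) refl))
    ; g-step = trans (∘-congˡ (sym ⟨⟩∘))
                 (trans (cancelˡ g-step) ⟨⟩∘)
    }
    where open Linked linked

  module _ (f : TwoCell S (T × X) S′ (V′ × Y))
           (g : TwoCell G V G′ T) (g′ : TwoCell G′ V′ G″ T′)
           {l : Z ⇒ (((⊤ × G) × (⊤ × ⊤)) × S) × V}
           {r : Z ⇒ (S × ((⊤ × G′) × (⊤ × ⊤))) × T}
           (linked : Linked g l r) (x : Z ⇒ X) where
    open Linked linked

    private
      l-step : Z ⇒ ((((⊤ × G′) × (⊤ × ⊤)) × S′) × V′) × Y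
      l-step = U ⌊ f ✶ (g ⊗id) ⌉ ∘ ⟨ l , x ⟩

      r-step : Z ⇒ ((S′ × ((⊤ × G″) × (⊤ × ⊤))) × T′) × Y
      r-step = U ⌊ (g′ ⊗id) ✶ f ⌉ ∘ ⟨ r , x ⟩

      -- The run of `f` that both sides share: on the left `t` has just been output by `g`, on the
      -- right it was fed back.
      q : Z ⇒ S′ × (V′ × Y)
      q = U f ∘ ⟨ b , ⟨ t , x ⟩ ⟩

      -- On the right `g′` already consumes the value that the left only feeds back. The next
      -- `g-step` therefore reduces to surjective pairing for `w`.
      w : Z ⇒ G″ × T′
      w = U g′ ∘ ⟨ c , π₁ ∘ (π₂ ∘ q) ⟩

      q-η : q ≈ ⟨ π₁ ∘ q , ⟨ π₁ ∘ (π₂ ∘ q) , π₂ ∘ (π₂ ∘ q) ⟩ ⟩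
      q-η = trans (sym η) (⟨⟩-cong refl (sym η))

      l-eval : l-step ≈ ⟨ ⟨ ⟨ pad c , π₁ ∘ q ⟩ , π₁ ∘ (π₂ ∘ q) ⟩ , π₂ ∘ (π₂ ∘ q) ⟩
      l-eval =
        trans (∘-congˡ (⟨⟩-cong left refl))
          (⌊⌉-eval (f ✶ (g ⊗id)) (✶-eval f (g ⊗id) (⊗id-eval g g-step) q-η))

      r-eval : r-step ≈ ⟨ ⟨ ⟨ π₁ ∘ q , pad (π₁ ∘ w) ⟩ , π₂ ∘ w ⟩ , π₂ ∘ (π₂ ∘ q) ⟩
      r-eval =
        trans (∘-congˡ (⟨⟩-cong right refl))
          (⌊⌉-eval ((g′ ⊗id) ✶ f)
            (✶-eval (g′ ⊗id) f q-η (⊗id-eval g′ (sym η))))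

    slide-state : Linked g′ (π₁ ∘ l-step) (π₁ ∘ r-step)
    slide-state = record
      { left = π₁-pair l-eval ; right = π₁-pair r-eval ; g-step = sym η }

    slide-out : π₂ ∘ l-step ≈ π₂ ∘ r-step
    slide-out = trans (π₂-pair l-eval) (sym (π₂-pair r-eval))

  module _ {T V X Y : ObjSeq}
           (s : Stateful (T ×ˢ X) (○ V ×ˢ Y)) (g : Stateful V T)
           (u : ⊤ ⇒ V 0) (j′ : ⊤ ⇒ state g 1) (u′ : ⊤ ⇒ T 0)
           (eq : ⟨ j′ , u′ ⟩ ≈ U (cells g 0) ∘ ⟨ init g , u ⟩) where
    open CartesianCategory (StCategory.St ℂ) using () renaming (_⁂_ to _⁂ˢ_)

    private
      L R : Stateful X Y
      L = tr V u (s ∘ˢ (g ⁂ˢ idˢ {X}))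
      R = tr T u′ ((tail g j′ ⁂ˢ idˢ {Y}) ∘ˢ s)

    before-linked : ∀ n → Linked (cells g n) (before L n) (before R n)
    -- The relation is built over `⊤` from the initial states, whose unit factors are `id`; `units`
    -- turns these into the `!` of `pad`.
    before-linked zero = Linked-∘ (record
      { left   = ⟨⟩-cong (⟨⟩-cong units refl) refl
      ; right  = ⟨⟩-cong (⟨⟩-cong refl units) refl
      ; g-step = sym eq
      }) !
      where
      units : {p q r : Z ⇒ ⊤} {a : Z ⇒ G} → ⟨ ⟨ p , a ⟩ , ⟨ q , r ⟩ ⟩ ≈ pad a
      units = ⟨⟩-cong (⟨⟩-cong !-unique₂ refl) (⟨⟩-cong !-unique₂ !-unique₂)
    before-linked (suc n) =
      -- `cells g (suc n)` is cell `n` of `tail g j′`; it is `g′` in this step and `g` in the next.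
      Linked-∘ (slide-state (cells s n) (cells g n) (cells g (suc n))
                            (before-linked n) (last X n)) π₁

    -- Truncations are assembled from the outputs at each time, so agreement of these outputs
    -- suffices.
    tr-sliding : L ≈ˢ R
    tr-sliding = out⇒≈ˢ {f = L} {g = R} λ n →
      slide-out (cells s n) (cells g n) (cells g (suc n))
                (before-linked n) (last X n)

theorem21 : ∀ {o ℓ e} (ℂ : StrictCartesianCategory o ℓ e) →
    let open DelayedTrace ℂ in
    ∀ {T V X Y : ObjSeq}
    (s : T ×ˢ X ⇒ˢ ○ V ×ˢ Y) (g : V ⇒ˢ T)
    (u : ⊤ ⇒ V 0) (j′ : ⊤ ⇒ state g 1) (u′ : ⊤ ⇒ T 0) →
    ⟨ j′ , u′ ⟩ ≈ U (cells g 0) ∘ ⟨ init g , u ⟩ →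
    tr V u (s ∘ˢ (g ⁂ˢ idˢ {X})) ≈ˢ tr T u′ ((tail g j′ ⁂ˢ idˢ {Y}) ∘ˢ s)
theorem21 ℂ = Sliding.tr-sliding ℂ
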